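{- Let $G$ be a connected graph of order $n$ with radius $\mathrm{rad}(G) \geq 3$. Then $\mathrm{vp}(G) \leq n - \mathrm{rad}(G) - 1$.
   Context: All graphs are finite, undirected and simple. A $u,v$-geodesic is a shortest $u,v$-path. The radius $\mathrm{rad}(G)$ is the minimum over vertices $x$ of the eccentricity $\max_{v \in V(G)} d(x,v)$. For a vertex $x$ of $G$, a set $S \subseteq V(G)$ is an $x$-position set if for every $y \in S$ no vertex of $S \setminus \{y\}$ lies on any $x,y$-geodesic in $G$. The $x$-position number $p_x(G)$ is the maximum cardinality of an $x$-position set of $G$. Define $\mathrm{vp}(G) = \max_{x \in V(G)} p_x(G)$. -}

module Defs where

open import Level using (0ℓ)
open import Data.Nat.Base
import Data.Nat.Properties as ℕ
open import Data.Nat.Properties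
  using (≤-trans; ≤∧≢⇒<; <⇒≱; m≤m⊔n; m≤n⊔m; anyUpTo?; allUpTo?)
open import Data.Fin.Base using (Fin; zero; suc)
import Data.Fin.Properties as Fin
open import Data.Fin.Properties using (any?; all?; injective⇒≤)
open import Data.Fin.Subset using (Subset; ∣_∣; ⊥) renaming (_∈_ to _∈ₛ_)
open import Data.Fin.Subset.Properties using (anySubset?; ∣p∣≤n; ∉⊥) renaming (_∈?_ to _∈ₛ?_)
import Data.List.Base as List
open import Data.List.Base using (List; []; _∷_)
open import Data.List.Membership.Propositional using (_∈_; _∉_)
open import Data.List.Relation.Unary.Unique.Propositional using (Unique)
open import Data.List.Membership.Propositional.Properties using (∈-lookup)
import Data.List.Relation.Unary.All as All
open import Data.List.Relation.Unary.AllPairs using (_∷_)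
import Data.List.Membership.DecPropositional as DecMembership
import Data.List.Relation.Unary.Unique.DecPropositional as DecUnique
open import Data.Product.Base using (∃; ∃-syntax; Σ-syntax; _×_; _,_; proj₁; proj₂)
open import Data.Empty using (⊥-elim)
open import Relation.Binary.Core using (Rel)
open import Relation.Binary.Definitions using (Symmetric; Irreflexive) renaming (Decidable to Decidable₂)
open import Relation.Binary.Construct.Closure.ReflexiveTransitive using (Star; ε; _◅_)
open import Relation.Binary.PropositionalEquality using (_≡_; _≢_; refl; sym; cong; subst)
open import Relation.Nullary.Decidable using (Dec; yes; no; map′; ¬?; _×-dec_; _→-dec_)
open import Relation.Nullary.Negation using (¬_)
open import Relation.Unary using (Pred; Decidable)

IsMinimum : Pred ℕ 0ℓ → Pred ℕ 0ℓ
IsMinimum P m = P m × (∀ k → P k → m ≤ k)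

IsMaximum : Pred ℕ 0ℓ → Pred ℕ 0ℓ
IsMaximum P m = P m × (∀ k → P k → k ≤ m)

minimum-exists : {P : Pred ℕ 0ℓ} → Decidable P → ∃ P → ∃ (IsMinimum P)
minimum-exists {P} P? (k , pk) = search P? k pk
  where
  search : {Q : Pred ℕ 0ℓ} → Decidable Q → ∀ k → Q k → ∃ (IsMinimum Q)
  search Q? zero qk = zero , qk , λ _ _ → z≤n
  search Q? (suc k) qk with Q? zero
  ... | yes q0 = zero , q0 , λ _ _ → z≤n
  ... | no ¬q0 with search (λ i → Q? (suc i)) k qk
  ...   | m , qm , least = suc m , qm , λ where
            zero    q0 → ⊥-elim (¬q0 q0)
            (suc j) qj → s≤s (least j qj)

maximum-exists : {P : Pred ℕ 0ℓ} → Decidable P → ∃ P →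
                 ∀ b → (∀ k → P k → k ≤ b) → ∃ (IsMaximum P)
maximum-exists {P} P? (k , pk) zero bound =
  zero , subst P (ℕ.n≤0⇒n≡0 (bound k pk)) pk , bound
maximum-exists P? p (suc b) bound with P? (suc b)
... | yes pb = suc b , pb , bound
... | no ¬pb = maximum-exists P? p b λ k pk →
        s≤s⁻¹ (≤∧≢⇒< (bound k pk) λ { refl → ¬pb pk })

lookup-injective : {A : Set} {xs : List A} → Unique xs →
                   ∀ i j → List.lookup xs i ≡ List.lookup xs j → i ≡ j
lookup-injective (_ ∷ _)  zero    zero    _  = refl
lookup-injective (x∉ ∷ _) zero    (suc j) eq = ⊥-elim (All.lookup x∉ (∈-lookup j) eq)
lookup-injective (x∉ ∷ _) (suc i) zero    eq = ⊥-elim (All.lookup x∉ (∈-lookup i) (sym eq))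
lookup-injective (_ ∷ u)  (suc i) (suc j) eq = cong suc (lookup-injective u i j eq)

module _ {n : ℕ} where

  Range : (Fin n → ℕ) → Pred ℕ 0ℓ
  Range f k = ∃[ i ] f i ≡ k

  range? : ∀ f → Decidable (Range f)
  range? f k = any? (λ i → f i ℕ.≟ k)

  range-nonempty : .{{NonZero n}} → ∀ f → ∃ (Range f)
  range-nonempty f = f point , point , refl
    where
    pointOf : ∀ m → .{{NonZero m}} → Fin m
    pointOf (suc _) = zero
    point = pointOf n

  range-bounded : ∀ f → ∃[ b ] (∀ k → Range f k → k ≤ b)
  range-bounded f = let b , le = go n f in b , λ { _ (i , refl) → le i }
    where
    go : ∀ m (g : Fin m → ℕ) → ∃[ b ] (∀ i → g i ≤ b)
    go zero    g = zero , λ ()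
    go (suc m) g with go m (λ i → g (suc i))
    ... | b , le = g zero ⊔ b , λ where
          zero    → m≤m⊔n (g zero) b
          (suc i) → ≤-trans (le i) (m≤n⊔m (g zero) b)

  minRange-exists : .{{NonZero n}} → ∀ f → ∃ (IsMinimum (Range f))
  minRange-exists f = minimum-exists (range? f) (range-nonempty f)

  maxRange-exists : .{{NonZero n}} → ∀ f → ∃ (IsMaximum (Range f))
  maxRange-exists f =
    maximum-exists (range? f) (range-nonempty f) (proj₁ (range-bounded f)) (proj₂ (range-bounded f))

-- Simple graphs of order n.  Decidability of adjacency is what makes
-- distances and the other extremal invariants computable.

record Graph (n : ℕ) : Set₁ where
  infix 4 _~_ _~?_
  field
    _~_      : Rel (Fin n) 0ℓ
    ~-sym    : Symmetric _~_
    ~-irrefl : Irreflexive _≡_ _~_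
    _~?_     : Decidable₂ _~_

-- Walks, paths and geodesics depend only on the adjacency relation;
-- taking it as the implicit parameter lets it be inferred from a walk.
module _ {n : ℕ} {_~_ : Rel (Fin n) 0ℓ} where

  length : ∀ {u v} → Star _~_ u v → ℕ
  length ε       = 0
  length (_ ◅ w) = suc (length w)

  vertices : ∀ {u v} → Star _~_ u v → List (Fin n)
  vertices {u} ε       = u ∷ []
  vertices {u} (_ ◅ w) = u ∷ vertices w

  IsPath : ∀ {u v} → Star _~_ u v → Set
  IsPath w = Unique (vertices w)

  IsGeodesic : ∀ {u v} → Star _~_ u v → Set
  IsGeodesic {u} {v} w = IsPath w × (∀ (w′ : Star _~_ u v) → IsPath w′ → length w ≤ length w′)

module _ {n : ℕ} (G : Graph n) where
  open Graph G

  Walk : Rel (Fin n) 0ℓ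
  Walk = Star _~_

  Connected : Set
  Connected = ∀ u v → Σ[ w ∈ Walk u v ] IsPath w

  PathLength : Fin n → Fin n → Pred ℕ 0ℓ
  PathLength u v k = Σ[ w ∈ Walk u v ] IsPath w × length w ≡ k

  -- x itself may belong to S; in a connected graph this forces S = {x}.
  IsPositionSet : Fin n → Subset n → Set
  IsPositionSet x S =
    ∀ y → y ∈ₛ S → ∀ z → z ∈ₛ S → z ≢ y →
    ∀ (w : Walk x y) → IsGeodesic w → z ∉ vertices w

  PositionSetSize : Fin n → Pred ℕ 0ℓ
  PositionSetSize x k = ∃[ S ] IsPositionSet x S × ∣ S ∣ ≡ k

  open DecMembership (Fin._≟_ {n}) using (_∈?_)
  open DecUnique (Fin._≟_ {n}) using (unique?)

  walk? : {Q : Pred (List (Fin n)) 0ℓ} → Decidable Q → ∀ k u v →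
          Dec (Σ[ w ∈ Walk u v ] length w ≡ k × Q (vertices w))
  walk? Q? zero u v with u Fin.≟ v
  ... | no u≢v = no λ { (ε , _) → u≢v refl }
  ... | yes refl = map′ (λ q → ε , refl , q) (λ { (ε , _ , q) → q }) (Q? (u ∷ []))
  walk? Q? (suc k) u v =
    map′ (λ { (_ , e , w , eq , q) → e ◅ w , cong suc eq , q })
         (λ { (e ◅ w , eq , q) → _ , e , w , ℕ.suc-injective eq , q })
         (any? λ t → (u ~? t) ×-dec walk? (λ l → Q? (u ∷ l)) k t v)

  pathLength? : ∀ u v → Decidable (PathLength u v)
  pathLength? u v k =
    map′ (λ { (w , eq , p) → w , p , eq }) (λ { (w , p , eq) → w , eq , p })
         (walk? unique? k u v)

  length<∣vertices∣ : ∀ {u v} (w : Walk u v) → length w < List.length (vertices w)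
  length<∣vertices∣ ε       = s≤s z≤n
  length<∣vertices∣ (_ ◅ w) = s≤s (length<∣vertices∣ w)

  path-length< : ∀ {u v} (w : Walk u v) → IsPath w → length w < n
  path-length< w p =
    ≤-trans (length<∣vertices∣ w) (injective⇒≤ (λ {i} {j} → lookup-injective p i j))

  onGeodesic? : ∀ u v z → Dec (Σ[ w ∈ Walk u v ] IsGeodesic w × z ∈ vertices w)
  onGeodesic? u v z =
    map′ (λ { (k , _ , (w , eq , p , z∈w) , none) →
              w , (p , λ w′ p′ → ℕ.≮⇒≥ λ lt →
                     none (subst (length w′ <_) eq lt) (w′ , p′ , refl)) , z∈w })
         (λ { (w , (p , least) , z∈w) →
              length w , path-length< w p , (w , refl , p , z∈w) ,
              λ { lt (w′ , p′ , eq) → <⇒≱ (subst (_< length w) (sym eq) lt) (least w′ p′) } })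
         (anyUpTo? (λ k → walk? (λ l → unique? l ×-dec (z ∈? l)) k u v
                          ×-dec allUpTo? (λ j → ¬? (pathLength? u v j)) k) n)

  isPositionSet? : ∀ x → Decidable (IsPositionSet x)
  isPositionSet? x S =
    map′ (λ h y y∈S z z∈S z≢y w g z∈w → h y y∈S z z∈S z≢y (w , g , z∈w))
         (λ h y y∈S z z∈S z≢y (w , g , z∈w) → h y y∈S z z∈S z≢y w g z∈w)
         (all? λ y → (y ∈ₛ? S) →-dec all? λ z → (z ∈ₛ? S) →-dec
            (¬? (z Fin.≟ y) →-dec ¬? (onGeodesic? x y z)))

  positionSetSize? : ∀ x → Decidable (PositionSetSize x)
  positionSetSize? x k = anySubset? λ S → isPositionSet? x S ×-dec (∣ S ∣ ℕ.≟ k)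

  module _ (c : Connected) where

    -- Here and below, the invariant is the first component of an
    -- existence proof; the second component is its defining property.
    dist-exists : ∀ u v → ∃ (IsMinimum (PathLength u v))
    dist-exists u v = minimum-exists (pathLength? u v)
      (let w , p = c u v in length w , w , p , refl)

    dist : Fin n → Fin n → ℕ
    dist u v = proj₁ (dist-exists u v)

    module _ .{{_ : NonZero n}} where

      ecc-exists : ∀ x → ∃ (IsMaximum (Range (dist x)))
      ecc-exists x = maxRange-exists (dist x)

      ecc : Fin n → ℕ
      ecc x = proj₁ (ecc-exists x)

      rad-exists : ∃ (IsMinimum (Range ecc))
      rad-exists = minRange-exists ecc

      rad : ℕ
      rad = proj₁ rad-exists

  positionNumber-exists : ∀ x → ∃ (IsMaximum (PositionSetSize x))
  positionNumber-exists x =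
    maximum-exists (positionSetSize? x)
      (∣ ⊥ {n} ∣ , ⊥ , (λ y y∈⊥ → ⊥-elim (∉⊥ y∈⊥)) , refl)
      n (λ { _ (S , _ , refl) → ∣p∣≤n S })

  positionNumber : Fin n → ℕ
  positionNumber x = proj₁ (positionNumber-exists x)

  module _ .{{_ : NonZero n}} where

    vp-exists : ∃ (IsMaximum (Range positionNumber))
    vp-exists = maxRange-exists positionNumber

    vp : ℕ
    vp = proj₁ vp-exists

{-# OPTIONS --safe #-}

-- Let S be an x-position set and P = x, u, … a geodesic from x to a vertex at
-- distance ecc(x).  Of any two vertices on a geodesic from x, the one nearer
-- to x lies on a geodesic to the other, so P meets S at most once and it
-- suffices to find a set of rad(G) + 2 vertices meeting S at most once.
-- If ecc(x) > rad(G), then P is one.  If ecc(x) = rad(G), choose w with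
-- d(u, w) ≥ rad(G) ≥ 3.  Then d(x, w) ≥ 2, and w is not on P.  A geodesic from
-- x to w starts with a neighbour t of x; t ≠ u since d(u, w) ≥ d(x, w), so t is
-- not on P either.  One of t, w is outside S and can be added to P.
module Submission where

open import Defs
open import Data.Nat.Base using (ℕ; NonZero; _≥_)
open import Data.Integer.Base using (+_; _-_; _≤_)

open import Data.Integer.Base using (_⊖_)
open import Level using (0ℓ)
import Data.Nat.Base as ℕ
open import Data.Nat.Base using (suc; s≤s; z≤n)
import Data.Nat.Properties as ℕ
import Data.Integer.Properties as ℤ
open import Data.Fin.Base using (Fin)
import Data.Fin.Properties as Fin
open import Data.Fin.Subset using (Subset; ∣_∣; ⁅_⁆; _∪_)
  renaming (_∈_ to _∈ₛ_; _∉_ to _∉ₛ_)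
open import Data.Fin.Subset.Properties
  using (∣p∣≤n; p⊂q⇒∣p∣<∣q∣; p⊆p∪q; x∈p∪q⁺; x∈p∪q⁻; x∈⁅x⁆; x∈⁅y⁆⇒x≡y)
  renaming (_∈?_ to _∈ₛ?_)
import Data.List.Base as List
open import Data.List.Base using (List; []; _∷_)
open import Data.List.Membership.Propositional using (_∈_; _∉_)
import Data.List.Membership.DecPropositional as DecMembership
open import Data.List.Relation.Unary.All as All using (All; []; _∷_)
import Data.List.Relation.Unary.All.Properties as All
open import Data.List.Relation.Unary.AllPairs as AllPairs using (AllPairs; []; _∷_)
open import Data.List.Relation.Unary.Any using (here; there)
open import Data.List.Relation.Unary.Unique.Propositional using (Unique)
open import Data.Product.Base using (∃-syntax; ∃₂; Σ-syntax; _×_; _,_; proj₁; proj₂)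
open import Data.Sum.Base using (inj₁; inj₂)
open import Function.Base using (_∘_)
open import Relation.Binary.Core using (Rel)
open import Relation.Binary.Construct.Closure.ReflexiveTransitive
  using (Star; ε; _◅_; _◅◅_)
open import Relation.Binary.Construct.Closure.ReflexiveTransitive.Properties
  using (◅◅-assoc)
open import Relation.Binary.PropositionalEquality
  using (_≡_; _≢_; refl; sym; trans; cong; subst; subst₂)
open import Relation.Nullary.Decidable using (yes; no)
open import Relation.Nullary.Negation using (contradiction)

-- Counting subsets against lists of distinct vertices.

module _ {n : ℕ} where

  ∣∪⁅⁆∣ : {S : Subset n} {a : Fin n} → a ∉ₛ S → ∣ S ∣ ℕ.< ∣ S ∪ ⁅ a ⁆ ∣
  ∣∪⁅⁆∣ {S} {a} a∉S =
    p⊂q⇒∣p∣<∣q∣ (p⊆p∪q ⁅ a ⁆ , a , x∈p∪q⁺ (inj₂ (x∈⁅x⁆ a)) , a∉S)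

  ∈-∪⁅⁆⁻ : {S : Subset n} {a b : Fin n} → a ≢ b → b ∈ₛ S ∪ ⁅ a ⁆ → b ∈ₛ S
  ∈-∪⁅⁆⁻ {S} {a} a≢b b∈ with x∈p∪q⁻ S ⁅ a ⁆ b∈
  ... | inj₁ b∈S = b∈S
  ... | inj₂ b∈a = contradiction (sym (x∈⁅y⁆⇒x≡y a b∈a)) a≢b

  -- Move the head of `l` into `S`: the sum does not drop, and the tail stays outside the larger set
  -- because its entries differ from the head.
  disjoint-bound : (S : Subset n) {l : List (Fin n)} → Unique l → All (_∉ₛ S) l →
                   ∣ S ∣ ℕ.+ List.length l ℕ.≤ n
  disjoint-bound S [] [] = subst (ℕ._≤ n) (sym (ℕ.+-identityʳ _)) (∣p∣≤n S)
  disjoint-bound S {a ∷ l} (a≢ ∷ unique) (a∉S ∷ l∉S) = begin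
    ∣ S ∣ ℕ.+ suc (List.length l)      ≡⟨ ℕ.+-suc _ _ ⟩
    suc (∣ S ∣) ℕ.+ List.length l      ≤⟨ ℕ.+-monoˡ-≤ _ (∣∪⁅⁆∣ a∉S) ⟩
    ∣ S ∪ ⁅ a ⁆ ∣ ℕ.+ List.length l    ≤⟨ disjoint-bound (S ∪ ⁅ a ⁆) unique
                                           (All.zipWith (λ (a≢b , b∉S) → b∉S ∘ ∈-∪⁅⁆⁻ a≢b) (a≢ , l∉S)) ⟩
    n                                  ∎
    where open ℕ.≤-Reasoning

  NotBothIn : Subset n → Rel (Fin n) 0ℓ
  NotBothIn S a b = a ∈ₛ S → b ∉ₛ S

  -- A head in `S` forces the tail to be disjoint from `S`, at the cost of the extra 1 in the bound.
  -- A head outside `S` is moved into `S`, which changes no membership in the tail.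
  atMostOne-bound : (S : Subset n) {l : List (Fin n)} → Unique l → AllPairs (NotBothIn S) l →
                    ∣ S ∣ ℕ.+ List.length l ℕ.≤ suc n
  atMostOne-bound S [] [] = ℕ.m≤n⇒m≤1+n (disjoint-bound S [] [])
  atMostOne-bound S {a ∷ l} (a≢ ∷ unique) (a# ∷ l#) with a ∈ₛ? S
  ... | yes a∈S = subst (ℕ._≤ suc n) (sym (ℕ.+-suc _ _))
                    (s≤s (disjoint-bound S unique (All.map (λ f → f a∈S) a#)))
  ... | no a∉S = begin
    ∣ S ∣ ℕ.+ suc (List.length l)      ≡⟨ ℕ.+-suc _ _ ⟩
    suc (∣ S ∣) ℕ.+ List.length l      ≤⟨ ℕ.+-monoˡ-≤ _ (∣∪⁅⁆∣ a∉S) ⟩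
    ∣ S ∪ ⁅ a ⁆ ∣ ℕ.+ List.length l    ≤⟨ atMostOne-bound (S ∪ ⁅ a ⁆) unique (extend a≢ l#) ⟩
    suc n                              ∎
    where
    open ℕ.≤-Reasoning
    extend : ∀ {k} → All (a ≢_) k → AllPairs (NotBothIn S) k →
             AllPairs (NotBothIn (S ∪ ⁅ a ⁆)) k
    extend [] [] = []
    extend (a≢b ∷ a≢k) (b# ∷ k#) =
      All.zipWith (λ (a≢c , b#c) b∈ c∈ → b#c (∈-∪⁅⁆⁻ a≢b b∈) (∈-∪⁅⁆⁻ a≢c c∈)) (a≢k , b#)
      ∷ extend a≢k k#

-- Walks, shortest walks and geodesics.

module _ {n : ℕ} {_~_ : Rel (Fin n) 0ℓ} where

  private
    Path : Rel (Fin n) 0ℓ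
    Path = Star _~_

  open DecMembership (Fin._≟_ {n}) using (_∈?_)

  -- The competitors are all walks, since elements of `Path` may repeat vertices. Segments can thus
  -- be exchanged without checking that the result is a path.
  Shortest : ∀ {u v} → Path u v → Set
  Shortest {u} {v} w = ∀ (w′ : Path u v) → length w ℕ.≤ length w′

  length-◅◅ : ∀ {u t v} (p : Path u t) (q : Path t v) →
              length (p ◅◅ q) ≡ length p ℕ.+ length q
  length-◅◅ ε       q = refl
  length-◅◅ (_ ◅ p) q = cong suc (length-◅◅ p q)

  length-vertices : ∀ {u v} (w : Path u v) → List.length (vertices w) ≡ suc (length w)
  length-vertices ε       = refl
  length-vertices (_ ◅ w) = cong suc (length-vertices w)

  start∈vertices : ∀ {u v} (w : Path u v) → u ∈ vertices w
  start∈vertices ε       = here refl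
  start∈vertices (_ ◅ _) = here refl

  middle∈vertices : ∀ {u t v} (p : Path u t) (q : Path t v) → t ∈ vertices (p ◅◅ q)
  middle∈vertices ε       q = start∈vertices q
  middle∈vertices (_ ◅ p) q = there (middle∈vertices p q)

  end∈vertices : ∀ {u v} (w : Path u v) → v ∈ vertices w
  end∈vertices ε       = here refl
  end∈vertices (_ ◅ w) = there (end∈vertices w)

  split : ∀ {u v z} (w : Path u v) → z ∈ vertices w →
          ∃₂ λ (p : Path u z) (q : Path z v) → p ◅◅ q ≡ w
  split ε       (here refl) = ε , ε , refl
  split (e ◅ w) (here refl) = ε , e ◅ w , refl
  split (e ◅ w) (there z∈w) with p , q , refl ← split w z∈w = e ◅ p , q , refl

  prefix-length : ∀ {u t v} (p : Path u t) (q : Path t v) {w : Path u v} →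
                  p ◅◅ q ≡ w → length p ℕ.≤ length w
  prefix-length p q refl = subst (length p ℕ.≤_) (sym (length-◅◅ p q)) (ℕ.m≤m+n _ _)

  suffix-length : ∀ {u t v} (p : Path u t) (q : Path t v) {w : Path u v} →
                  p ◅◅ q ≡ w → length q ℕ.≤ length w
  suffix-length p q refl = subst (length q ℕ.≤_) (sym (length-◅◅ p q)) (ℕ.m≤n+m _ _)

  suffix-isPath : ∀ {u t v} (p : Path u t) (q : Path t v) → IsPath (p ◅◅ q) → IsPath q
  suffix-isPath ε       q path       = path
  suffix-isPath (_ ◅ p) q (_ ∷ path) = suffix-isPath p q path

  -- If the start recurs in the shortened tail, everything before that recurrence is cut off.
  shorten-to-path : ∀ {u v} (w : Path u v) → Σ[ w′ ∈ Path u v ] IsPath w′ × length w′ ℕ.≤ length w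
  shorten-to-path ε = ε , [] ∷ [] , z≤n
  shorten-to-path {u} (e ◅ w) with shorten-to-path w
  ... | w′ , path , w′≤w with u ∈? vertices w′
  ...   | no u∉w′ = e ◅ w′ , All.¬Any⇒All¬ _ u∉w′ ∷ path , s≤s w′≤w
  ...   | yes u∈w′ with p , q , refl ← split w′ u∈w′ =
            q , suffix-isPath p q path ,
            ℕ.m≤n⇒m≤1+n (ℕ.≤-trans (suffix-length p q refl) w′≤w)

  -- A shorter replacement for `p`, followed by `q`, would beat `w`.
  shortest-prefix : ∀ {u t v} (p : Path u t) (q : Path t v) {w : Path u v} →
                    p ◅◅ q ≡ w → Shortest w → Shortest p
  shortest-prefix p q refl sh p′ =
    ℕ.+-cancelʳ-≤ (length q) _ _ (subst₂ ℕ._≤_ (length-◅◅ p q) (length-◅◅ p′ q) (sh (p′ ◅◅ q)))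

  shortest-tail : ∀ {u t v} (e : u ~ t) (w : Path t v) → Shortest (e ◅ w) → Shortest w
  shortest-tail e w sh w′ = ℕ.s≤s⁻¹ (sh (e ◅ w′))

  -- If the start occurred again, the suffix from that occurrence would be shorter.
  shortest⇒path : ∀ {u v} (w : Path u v) → Shortest w → IsPath w
  shortest⇒path ε       sh = [] ∷ []
  shortest⇒path (e ◅ w) sh =
    All.¬Any⇒All¬ _ u∉w ∷ shortest⇒path w (shortest-tail e w sh)
    where
    u∉w : _ ∉ vertices w
    u∉w u∈w = let p , q , eq = split w u∈w in ℕ.<⇒≱ (s≤s (suffix-length p q eq)) (sh q)

  shortest⇒geodesic : ∀ {u v} (w : Path u v) → Shortest w → IsGeodesic w
  shortest⇒geodesic w sh = shortest⇒path w sh , λ w′ _ → sh w′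

-- Position sets along geodesics.

module _ {n : ℕ} (G : Graph n) where
  open Graph G

  position-notBoth : ∀ {x S} → IsPositionSet G x S → ∀ {a b} (p : Walk G x a) (q : Walk G a b) →
                     Shortest (p ◅◅ q) → a ≢ b → NotBothIn S a b
  position-notBoth pos p q sh a≢b a∈S b∈S =
    pos _ b∈S _ a∈S a≢b (p ◅◅ q) (shortest⇒geodesic _ sh) (middle∈vertices p q)

  -- The walk p from x to the start of w keeps the base point x fixed while w
  -- shrinks in the recursion.
  position-allPairs : ∀ {x S} → IsPositionSet G x S → ∀ {u v} (p : Walk G x u) (w : Walk G u v) →
                      Shortest (p ◅◅ w) → AllPairs (NotBothIn S) (vertices w)
  position-allPairs pos p ε sh = [] ∷ []
  position-allPairs {x} {S} pos {u} p (e ◅ w) sh =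
    All.tabulate first ∷ position-allPairs pos (p ◅◅ (e ◅ ε)) w sh′
    where
    sh′ : Shortest ((p ◅◅ (e ◅ ε)) ◅◅ w)
    sh′ = subst Shortest (sym (◅◅-assoc p (e ◅ ε) w)) sh

    path : IsPath (e ◅ w)
    path = suffix-isPath p (e ◅ w) (shortest⇒path _ sh)

    first : ∀ {b} → b ∈ vertices w → NotBothIn S u b
    first b∈w =
      let q , r , eq = split w b∈w in
      position-notBoth pos p (e ◅ q)
        (shortest-prefix (p ◅◅ (e ◅ q)) r
          (trans (◅◅-assoc p (e ◅ q) r) (cong (λ w → p ◅◅ (e ◅ w)) eq)) sh)
        (All.lookup (AllPairs.head path) b∈w)

  ShortestWalk : Fin n → Fin n → ℕ → Set
  ShortestWalk u v k = Σ[ w ∈ Walk G u v ] Shortest w × length w ≡ k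

  -- A relational form with explicit shortest walks, so that the combinatorial argument never
  -- unfolds `dist` or `ecc`.
  Eccentricity : Fin n → ℕ → Set
  Eccentricity x e = (∃[ v ] ShortestWalk x v e) × (∀ v → ∃[ k ] ShortestWalk x v k × k ℕ.≤ e)

  -- The last hypothesis says d(u, w) ≥ `r`. Both `w` and the second vertex of `Q` avoid `a ◅ P`,
  -- and `S` contains at most one of them.
  position-off-geodesic :
    ∀ {r x S} → r ≥ 3 → IsPositionSet G x S →
    ∀ {u v} (a : x ~ u) (P : Walk G u v) → Shortest (a ◅ P) → length (a ◅ P) ℕ.≤ r →
    ∀ {w} (Q : Walk G x w) → Shortest Q → length Q ℕ.≤ r →
    (∀ (p : Walk G u w) → r ℕ.≤ length p) →
    ∃[ z ] z ∉ vertices (a ◅ P) × z ∉ₛ S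
  position-off-geodesic {r} {x} {S} r≥3 pos {u} a P sh P≤r {w} Q shQ Q≤r r≤length = find Q shQ Q≤r
    where
    3≤length : (p : Walk G u w) → 3 ℕ.≤ length p
    3≤length p = ℕ.≤-trans r≥3 (r≤length p)

    w∉aP : w ∉ vertices (a ◅ P)
    -- If `w` were `x`, the edge `a` reversed would join `u` to `w`.
    w∉aP (here refl) with s≤s () ← 3≤length (~-sym a ◅ ε)
    w∉aP (there w∈P) =
      let p , q , eq = split P w∈P in
      ℕ.<⇒≱ (ℕ.≤-trans (s≤s (prefix-length p q eq)) P≤r) (r≤length p)

    find : (Q : Walk G x w) → Shortest Q → length Q ℕ.≤ r →
           ∃[ z ] z ∉ vertices (a ◅ P) × z ∉ₛ S
    find ε shQ Q≤r = contradiction (here refl) w∉aP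
    -- Here `u`, `x`, `w` is a walk of length 2.
    find (b ◅ ε) shQ Q≤r with s≤s (s≤s ()) ← 3≤length (~-sym a ◅ b ◅ ε)
    find (_◅_ {j = t} b (b′ ◅ Q)) shQ Q≤r with t ∈ₛ? S
    ... | yes t∈S = w , w∉aP , position-notBoth pos (b ◅ ε) (b′ ◅ Q) shQ t≢w t∈S
      where
      t≢w : t ≢ w
      t≢w = All.lookup (AllPairs.head (shortest⇒path (b′ ◅ Q) (shortest-tail b (b′ ◅ Q) shQ)))
                       (end∈vertices Q)
    ... | no t∉S = t , t∉aP , t∉S
      where
      t≢u : t ≢ u
      -- Otherwise `Q` without its first edge would lead from `u` to `w` in fewer than `r` steps.
      t≢u refl = ℕ.<⇒≱ Q≤r (r≤length (b′ ◅ Q))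

      t∉aP : t ∉ vertices (a ◅ P)
      t∉aP (here t≡x) = ~-irrefl (sym t≡x) b
      t∉aP (there t∈P) with split P t∈P
      ... | ε , _ , _ = t≢u refl
      -- The geodesic reaches `t` after at least two edges, but `b` joins `x` to `t` directly.
      ... | e ◅ p , q , eq with s≤s () ← shortest-prefix (a ◅ e ◅ p) q (cong (a ◅_) eq) sh (b ◅ ε)

  positionSet-bound : ∀ {r x S} → r ≥ 3 → (∀ y → ∃[ e ] r ℕ.≤ e × Eccentricity y e) →
                      IsPositionSet G x S → ∣ S ∣ ℕ.+ suc r ℕ.≤ n
  positionSet-bound {r} {x} {S} r≥3 ecc≥r pos with ecc≥r x
  ... | _ , r≤e , (_ , ε , _ , refl) , _ with () ← ℕ.≤-trans r≥3 r≤e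
  ... | _ , r≤e , (_ , _◅_ {j = u} a P , sh , refl) , within = bound
    where
    conclude : {l : List (Fin n)} → Unique l → AllPairs (NotBothIn S) l →
               suc (suc r) ℕ.≤ List.length l → ∣ S ∣ ℕ.+ suc r ℕ.≤ n
    conclude {l} unique l# long = ℕ.s≤s⁻¹ (begin
      suc (∣ S ∣ ℕ.+ suc r)      ≡⟨ ℕ.+-suc _ _ ⟨
      ∣ S ∣ ℕ.+ suc (suc r)      ≤⟨ ℕ.+-monoʳ-≤ ∣ S ∣ long ⟩
      ∣ S ∣ ℕ.+ List.length l    ≤⟨ atMostOne-bound S unique l# ⟩
      suc n                      ∎)
      where open ℕ.≤-Reasoning

    path : IsPath (a ◅ P)
    path = shortest⇒path (a ◅ P) sh

    atMostOne : AllPairs (NotBothIn S) (vertices (a ◅ P))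
    atMostOne = position-allPairs pos ε (a ◅ P) sh

    <vertices : ∀ {k} → k ℕ.≤ length (a ◅ P) → k ℕ.< List.length (vertices (a ◅ P))
    <vertices {k} k≤ = subst (k ℕ.<_) (sym (length-vertices (a ◅ P))) (s≤s k≤)

    bound : ∣ S ∣ ℕ.+ suc r ℕ.≤ n
    -- If `e` exceeds `r`, the geodesic alone has `r` + 2 vertices. Otherwise it has `r` + 1, and
    -- `z` is added.
    bound with length (a ◅ P) ℕ.≤? r
    ... | no e≰r = conclude path atMostOne (<vertices (ℕ.≰⇒> e≰r))
    ... | yes e≤r =
      -- `w` is a vertex farthest from `u`.
      let _ , r≤e′ , (w , R , shR , R≡) , _ = ecc≥r u
          _ , (Q , shQ , Q≡) , k≤e = within w
          z , z∉ , z∉S = position-off-geodesic r≥3 pos a P sh e≤r Q shQ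
            (ℕ.≤-trans (ℕ.≤-reflexive Q≡) (ℕ.≤-trans k≤e e≤r))
            (λ p → ℕ.≤-trans r≤e′ (subst (ℕ._≤ length p) R≡ (shR p)))
      in conclude (All.¬Any⇒All¬ _ z∉ ∷ path)
           (All.tabulate (λ _ z∈S → contradiction z∈S z∉S) ∷ atMostOne)
           (s≤s (<vertices r≤e))

  -- Passage to distance, eccentricity, radius and vp.

  minimum⇒shortestWalk : ∀ {u v d} → IsMinimum (PathLength G u v) d → ShortestWalk u v d
  minimum⇒shortestWalk ((w , _ , refl) , least) =
    -- `least` compares with paths only; shortening `w′` extends this to all walks.
    w , (λ w′ → let p , path , p≤w′ = shorten-to-path w′
                in ℕ.≤-trans (least _ (p , path , refl)) p≤w′) , refl

  maximum⇒eccentricity : ∀ {x e} (d : Fin n → ℕ) → (∀ v → ShortestWalk x v (d v)) →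
                         IsMaximum (Range d) e → Eccentricity x e
  maximum⇒eccentricity d shortest ((v , refl) , greatest) =
    (v , shortest v) , λ v′ → d v′ , shortest v′ , greatest (d v′) (v′ , refl)

  module _ (c : Connected G) .{{_ : NonZero n}} where

    ecc-eccentricity : ∀ x → Eccentricity x (ecc G c x)
    ecc-eccentricity x = maximum⇒eccentricity (dist G c x)
      (λ v → minimum⇒shortestWalk (proj₂ (dist-exists G c x v)))
      (proj₂ (ecc-exists G c x))

    rad≤ecc : ∀ x → rad G c ℕ.≤ ecc G c x
    rad≤ecc x = proj₂ (proj₂ (rad-exists G c)) (ecc G c x) (x , refl)

    positionNumber-bound : rad G c ≥ 3 → ∀ x → positionNumber G x ℕ.+ suc (rad G c) ℕ.≤ n
    positionNumber-bound r≥3 x =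
      let S , pos , S≡ = proj₁ (proj₂ (positionNumber-exists G x)) in
      subst (λ k → k ℕ.+ suc (rad G c) ℕ.≤ n) S≡
        (positionSet-bound r≥3 (λ y → ecc G c y , rad≤ecc y , ecc-eccentricity y) pos)

    vp-bound : rad G c ≥ 3 → vp G ℕ.+ suc (rad G c) ℕ.≤ n
    vp-bound r≥3 =
      let x , pn≡ = proj₁ (proj₂ (vp-exists G)) in
      subst (λ k → k ℕ.+ suc (rad G c) ℕ.≤ n) pn≡ (positionNumber-bound r≥3 x)

-- Translation to integer subtraction.

m+1+r≤n⇒m≤n-r-1 : ∀ m n r → m ℕ.+ suc r ℕ.≤ n → + m ≤ + n - + r - + 1
m+1+r≤n⇒m≤n-r-1 m n r h = begin
  + m                          ≡⟨ cong +_ (ℕ.m+n∸n≡m m (suc r)) ⟨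
  + (m ℕ.+ suc r ℕ.∸ suc r)    ≡⟨ ℤ.⊖-≥ (ℕ.m≤n+m (suc r) m) ⟨
  (m ℕ.+ suc r) ⊖ suc r        ≤⟨ ℤ.⊖-monoˡ-≤ (suc r) h ⟩
  -- Subtracting 1 means adding `-[1+ 0 ]`, hence the summand 0.
  n ⊖ suc r                    ≡⟨ cong (λ k → n ⊖ suc k) (ℕ.+-identityʳ r) ⟨
  n ⊖ (suc r ℕ.+ 0)            ≡⟨ ℤ.distribˡ-⊖-+-neg 0 n r ⟨
  n ⊖ r - + 1                  ≡⟨ cong (_- + 1) (ℤ.[+m]-[+n]≡m⊖n n r) ⟨
  + n - + r - + 1              ∎
  where open ℤ.≤-Reasoning

theorem2p11 : ∀ (n : ℕ) .{{_ : NonZero n}} (G : Graph n) (c : Connected G) →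
    rad G c ≥ 3 →
    + (vp G) ≤ + n - + (rad G c) - + 1
theorem2p11 n G c r≥3 = m+1+r≤n⇒m≤n-r-1 (vp G) n (rad G c) (vp-bound G c r≥3)
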